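{- Let $\mathcal{R}$ be a finite valuation ring of order $q^r$, where $q$ is a power of an odd prime. There is an absolute constant $C>0$ such that for every $\mathcal{A}\subset\mathcal{R}$ with $|\mathcal{A}|\ge 2q^{r-1}$, \[\max\left\{ |\mathcal{A}+\mathcal{A}|,\ |\mathcal{A}^2+\mathcal{A}^2|\right\}\ \ge\ C\min\left\{ q^{\frac{r}{2}}|\mathcal{A}|^{\frac12},\ \frac{|\mathcal{A}|^2}{q^{\frac{2r-1}{2}}}\right\}.\]
   Context: A finite valuation ring is a finite, local, principal commutative ring with identity. Its unique maximal ideal is $(z)$ for a uniformizer $z$; the residue field $\mathcal{R}/(z)$ has $q$ elements; $r$ is the smallest positive integer with $z^r=0$; then $|\mathcal{R}|=q^r$ and $|(z)|=q^{r-1}$. For $\mathcal{A}\subset\mathcal{R}$: $\mathcal{A}+\mathcal{A}=\{a+b: a,b\in\mathcal{A}\}$, $\mathcal{A}^2=\{x^2: x\in\mathcal{A}\}$, and $\mathcal{A}^2+\mathcal{A}^2=\{u+v: u,v\in\mathcal{A}^2\}$. -}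

module Defs where

open import Algebra.Bundles using (CommutativeRing)
import Algebra.Properties.Semiring.Exp as SemiringExp
import Algebra.Properties.AbelianGroup as AbelianGroupProperties
import Algebra.Properties.Ring as RingProperties
open import Data.Fin.Base using (Fin)
open import Data.Fin.Properties using (any?; _≟_)
open import Data.Fin.Subset as Subset using (Subset; ⊤; _⊆_)
open import Data.Fin.Subset.Properties using (_∈?_)
open import Data.Integer.Base using (+_)
open import Data.Nat.Base as ℕ using (ℕ; NonZero; _∸_; _^_; _<_; _≤_)
open import Data.Nat.Properties using (m^n≢0)
open import Data.Nat.Primality using (Prime)
open import Data.Product using (∃-syntax; ∃!; _×_; proj₁; proj₂)
open import Data.Rational.Base using (ℚ; _/_; _⊓_)
open import Data.Sum.Base using (_⊎_)
open import Data.Vec.Base using (tabulate)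
open import Function.Base using (_∘_)
open import Function.Bundles using (Inverse)
open import Level using (Level; suc; _⊔_)
open import Relation.Binary.Bundles using (Setoid)
open import Relation.Binary.PropositionalEquality as ≡ using (_≡_; _≢_)
open import Relation.Nullary.Decidable using (does; _×-dec_)
open import Relation.Unary using (Pred; Decidable)

private
  variable
    c ℓ p : Level

HasSize : Setoid c ℓ → ℕ → Set (c ⊔ ℓ)
HasSize S n = Inverse S (≡.setoid (Fin n))

OddPrimePower : ℕ → Set
OddPrimePower q = ∃[ p ] ∃[ k ] (Prime p × p ≢ 2 × 0 < k × q ≡ p ^ k)

fromℕ : ℕ → ℚ
fromℕ n = + n / 1

-- The square of min { q^(r/2) · n^(1/2) , n² / q^((2r-1)/2) }. Its two terms
-- are irrational in general, but their squares are rational, and squaring is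
-- monotone on non-negative numbers, so it commutes with min. The truncated
-- subtraction is exact, as r is positive wherever this is used.
min² : (q r n : ℕ) .{{_ : NonZero q}} → ℚ
min² q r n = fromℕ (q ^ r ℕ.* n) ⊓ (+ (n ^ 4) / q ^ (2 ℕ.* r ∸ 1))
  where instance _ = m^n≢0 q (2 ℕ.* r ∸ 1)

comprehension : ∀ {n} {P : Pred (Fin n) p} → Decidable P → Subset n
comprehension P? = tabulate (does ∘ P?)

record FiniteCommutativeRing (c ℓ : Level) : Set (suc (c ⊔ ℓ)) where
  field
    commutativeRing : CommutativeRing c ℓ

  open CommutativeRing commutativeRing public

  field
    order       : ℕ
    enumeration : HasSize setoid order

  open SemiringExp semiring public
    using () renaming (_^_ to _^ʳ_)

  index : Carrier → Fin order
  index = Inverse.to enumeration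

  element : Fin order → Carrier
  element = Inverse.from enumeration

  -- A subset of the ring is the Boolean vector of its members' indices. Hence
  -- every subset (in particular every ideal) is decidable and respects _≈_,
  -- and propositional equality of subsets is extensional equality.
  𝒫 : Set
  𝒫 = Subset order

  infix 4 _∈_
  _∈_ : Carrier → 𝒫 → Set
  x ∈ A = index x Subset.∈ A

  infixl 6 _⊕_
  _⊕_ : 𝒫 → 𝒫 → 𝒫
  A ⊕ B = comprehension λ k → any? λ i → any? λ j →
    i ∈? A ×-dec j ∈? B ×-dec k ≟ index (element i + element j)

  squares : 𝒫 → 𝒫
  squares A = comprehension λ k → any? λ i →
    i ∈? A ×-dec k ≟ index (element i * element i)

  ⟨_⟩ : Carrier → 𝒫
  ⟨ x ⟩ = comprehension λ k → any? λ i → k ≟ index (element i * x)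

  record IsIdeal (I : 𝒫) : Set c where
    field
      0∈       : 0# ∈ I
      +-closed : ∀ {x y} → x ∈ I → y ∈ I → x + y ∈ I
      *-closed : ∀ x {y} → y ∈ I → x * y ∈ I

  record IsMaximal (M : 𝒫) : Set c where
    field
      isIdeal : IsIdeal M
      proper  : M ≢ ⊤
      maximal : ∀ I → IsIdeal I → M ⊆ I → I ≡ M ⊎ I ≡ ⊤

  IsLocal : Set c
  IsLocal = ∃! _≡_ IsMaximal

  IsPrincipal : Set c
  IsPrincipal = ∀ I → IsIdeal I → ∃[ x ] I ≡ ⟨ x ⟩

  -- The underlying set of the quotient of the ring by I.
  quotient : ∀ {I} → IsIdeal I → Setoid c Level.zero
  quotient {I} isIdeal = record
    { Carrier       = Carrier
    ; _≈_           = λ x y → x - y ∈ I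
    ; isEquivalence = record
      { refl  = λ {x} → resp (sym (-‿inverseʳ x)) 0∈
      ; sym   = λ {x} {y} x-y∈I →
          resp (trans (-1*x≈-x (x - y)) (⁻¹-anti-homo‿- x y)) (*-closed (- 1#) x-y∈I)
      ; trans = λ {x} {y} {z} x-y∈I y-z∈I →
          resp (telescope x y z) (+-closed x-y∈I y-z∈I)
      }
    }
    where
    open IsIdeal isIdeal
    open RingProperties ring using (-1*x≈-x)
    open AbelianGroupProperties +-abelianGroup using (⁻¹-anti-homo‿-)
    open import Relation.Binary.Reasoning.Setoid setoid

    resp : ∀ {x y} → x ≈ y → x ∈ I → y ∈ I
    resp x≈y = ≡.subst (Subset._∈ I) (Inverse.to-cong enumeration x≈y)

    telescope : ∀ x y z → (x - y) + (y - z) ≈ x - z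
    telescope x y z = begin
      (x - y) + (y - z)      ≈⟨ +-assoc x (- y) (y - z) ⟩
      x + (- y + (y - z))    ≈⟨ +-congˡ (+-assoc (- y) y (- z)) ⟨
      x + ((- y + y) - z)    ≈⟨ +-congˡ (+-congʳ (-‿inverseˡ y)) ⟩
      x + (0# - z)           ≈⟨ +-congˡ (+-identityˡ (- z)) ⟩
      x - z                  ∎

record FiniteValuationRing (c ℓ : Level) : Set (suc (c ⊔ ℓ)) where
  field
    finiteCommutativeRing : FiniteCommutativeRing c ℓ

  open FiniteCommutativeRing finiteCommutativeRing public

  field
    isLocal     : IsLocal
    isPrincipal : IsPrincipal

  𝔪 : 𝒫
  𝔪 = proj₁ isLocal

  residueField : Setoid c Level.zero
  residueField = quotient (isIdeal (proj₁ (proj₂ isLocal)))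
    where open IsMaximal

  IsUniformizer : Carrier → Set
  IsUniformizer z = 𝔪 ≡ ⟨ z ⟩

  IsNilpotencyIndex : Carrier → ℕ → Set ℓ
  IsNilpotencyIndex z r =
    0 < r × z ^ʳ r ≈ 0# × (∀ s → 0 < s → z ^ʳ s ≈ 0# → r ≤ s)

{-# OPTIONS --safe #-}

-- Let S = A + A, T = A² + A² and N = |R|. For a ∈ A and c ∈ A², the parabola
-- t = (s - a)² + c passes through the |A| points (a + x , x² + c), x ∈ A, of
-- S × T. Averaged over all a, c ∈ R, the number of points of S × T on such a
-- parabola is |S||T| / N. For its variance, parabolas through two points with
-- abscissae s and s + d are counted: if d is a unit, then the gap between the
-- squares, d (d + 2 (s - a)), is a bijective function of a, so that on average
-- the two points behave independently; the at most |S||𝔪| remaining pairs of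
-- abscissae are bounded trivially. Chebyshev's inequality then gives
-- |A|⁴ ≤ 16 |S||T||𝔪|N unless N|A| ≤ 2|S||T|, since |A| ≤ 4|A²|: at most half
-- of A lies in 𝔪, and outside 𝔪 squaring is at most two-to-one.
module Submission where

open import Algebra.Bundles using (CommutativeRing; RawRing)
import Algebra.Morphism.RingMonomorphism as RingMonomorphism
open import Algebra.Morphism.Structures using (IsRingMonomorphism)
open import Algebra.Structures using (IsCommutativeRing)
open import Data.Bool.Base using (true; false; if_then_else_)
open import Data.Fin.Base using (Fin; zero; suc)
open import Data.Fin.Permutation using (Permutation′; permutation; _⟨$⟩ʳ_)
open import Data.Fin.Properties using (any?; _≟_; nonZeroIndex)
open import Data.Fin.Subset as Subset using (Subset; ∣_∣; _∈_; _∉_; ⁅_⁆)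
open import Data.Fin.Subset.Properties
  using (_∈?_; x∈⁅y⁆⇒x≡y; x∈⁅x⁆; ∣⁅x⁆∣≡1; ∈⊤; x∈p∧x∉q⇒x∈p─q; p─q⊆p)
import Data.Integer.Base as ℤ
import Data.Integer.Properties as ℤ
open import Data.Nat.Base
  using (ℕ; zero; suc; NonZero; _+_; _*_; _∸_; _^_; _≤_; _⊔_; ∣_-_∣; z≤n; s≤s)
open import Data.Nat.DivMod using (_/_; _%_; m≡m%n+[m/n]*n; m%n<n)
open import Data.Nat.Divisibility using (_∣_; ∣1⇒≡1; m%n≡0⇒n∣m)
open import Data.Nat.Primality using (prime[2]; prime⇒irreducible; euclidsLemma)
open import Data.Nat.Properties hiding (_≟_)
open import Algebra.Properties.Semiring.Sum +-*-semiring
  using (sum; sum-cong-≗; ∑-distrib-+; ∑-comm; sum-permute; *-distribˡ-sum; *-distribʳ-sum)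
open import Data.Nat.Tactic.RingSolver using (solve-∀)
open import Data.Product.Base using (∃-syntax; _×_; _,_; proj₁; proj₂)
open import Data.Rational.Base as ℚ using (ℚ; 0ℚ)
import Data.Rational.Properties as ℚ
open import Data.Rational.Unnormalised.Base as ℚᵘ using (mkℚᵘ; *≤*)
import Data.Rational.Unnormalised.Properties as ℚᵘ
open import Data.Sum.Base using (_⊎_; inj₁; inj₂; [_,_]′)
open import Data.Vec.Base using (_∷_; []; lookup; here; there)
open import Data.Vec.Properties using ([]=⇒lookup; lookup⇒[]=; lookup∘tabulate)
open import Defs
open import Function.Base using (_∘_; case_of_)
open import Function.Bundles using (Inverse)
open import Level using (Level; 0ℓ)
open import Relation.Binary.PropositionalEquality
  using (_≡_; _≢_; refl; sym; trans; cong; cong₂; subst; subst₂; module ≡-Reasoning)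
open import Relation.Nullary using (¬_; yes; no; contradiction)
open import Relation.Nullary.Decidable using (_×-dec_; does; dec-true)
open import Relation.Unary using (Pred; Decidable)

private
  variable
    m n : ℕ

-- Finite sums and double sums of natural numbers.

sum-mono-≤ : (f g : Fin n → ℕ) → (∀ i → f i ≤ g i) → sum f ≤ sum g
sum-mono-≤ {zero}  f g f≤g = z≤n
sum-mono-≤ {suc n} f g f≤g = +-mono-≤ (f≤g zero) (sum-mono-≤ (f ∘ suc) (g ∘ suc) (f≤g ∘ suc))

sum-const : ∀ n k → sum {n} (λ _ → k) ≡ n * k
sum-const zero    k = refl
sum-const (suc n) k = cong (k +_) (sum-const n k)

sum-reindex : (π : Permutation′ n) (f : Fin n → ℕ) → sum (λ i → f (π ⟨$⟩ʳ i)) ≡ sum f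
sum-reindex π f = sym (sum-permute f π)

∑∑ : (Fin m → Fin n → ℕ) → ℕ
∑∑ f = sum λ i → sum λ j → f i j

∑∑-cong : {f g : Fin m → Fin n → ℕ} → (∀ i j → f i j ≡ g i j) → ∑∑ f ≡ ∑∑ g
∑∑-cong f≗g = sum-cong-≗ λ i → sum-cong-≗ (f≗g i)

∑∑-mono-≤ : (f g : Fin m → Fin n → ℕ) → (∀ i j → f i j ≤ g i j) → ∑∑ f ≤ ∑∑ g
∑∑-mono-≤ f g f≤g = sum-mono-≤ _ _ λ i → sum-mono-≤ (f i) (g i) (f≤g i)

∑∑-distrib-+ : (f g : Fin m → Fin n → ℕ) → ∑∑ (λ i j → f i j + g i j) ≡ ∑∑ f + ∑∑ g
∑∑-distrib-+ f g = trans (sum-cong-≗ λ i → ∑-distrib-+ (f i) (g i)) (∑-distrib-+ (sum ∘ f) (sum ∘ g))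

∑∑-*ˡ : (k : ℕ) (f : Fin m → Fin n → ℕ) → ∑∑ (λ i j → k * f i j) ≡ k * ∑∑ f
∑∑-*ˡ k f = sym (trans (*-distribˡ-sum k (sum ∘ f)) (sum-cong-≗ λ i → *-distribˡ-sum k (f i)))

∑∑-const : ∀ m n k → ∑∑ {m} {n} (λ _ _ → k) ≡ m * (n * k)
∑∑-const m n k = trans (sum-const m _) (cong (m *_) (sum-const n k))

∑∑-product : (f : Fin m → ℕ) (g : Fin n → ℕ) → ∑∑ (λ i j → f i * g j) ≡ sum f * sum g
∑∑-product f g = sym (trans (*-distribʳ-sum (sum g) f) (sum-cong-≗ λ i → *-distribˡ-sum (f i) g))

-- Indicator functions and counting by fibres.

χ : Subset n → Fin n → ℕ
χ A i = if lookup A i then 1 else 0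

χ-∈ : {A : Subset n} {i : Fin n} → i ∈ A → χ A i ≡ 1
χ-∈ i∈A rewrite []=⇒lookup i∈A = refl

χ-∉ : (A : Subset n) (i : Fin n) → i ∉ A → χ A i ≡ 0
χ-∉ A i i∉A with lookup A i in eq
... | true  = contradiction (lookup⇒[]= i A eq) i∉A
... | false = refl

χ≤1 : (A : Subset n) (i : Fin n) → χ A i ≤ 1
χ≤1 A i with lookup A i
... | true  = ≤-refl
... | false = z≤n

sum-χ : (A : Subset n) → sum (χ A) ≡ ∣ A ∣
sum-χ []          = refl
sum-χ (true  ∷ A) = cong suc (sum-χ A)
sum-χ (false ∷ A) = sum-χ A

sum-χ⁅_⁆ : (i : Fin n) → sum (χ ⁅ i ⁆) ≡ 1
sum-χ⁅ i ⁆ = trans (sum-χ ⁅ i ⁆) (∣⁅x⁆∣≡1 i)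

-- Each `i` lies in exactly one fibre of `f`, the one over `f i`. The weight `w` serves two counts:
-- `χ A` restricts the fibres to a subset, and the constant 1 counts the whole domain.
∑∑-fibres : (f : Fin m → Fin n) (w : Fin m → ℕ) → ∑∑ (λ j i → w i * χ ⁅ f i ⁆ j) ≡ sum w
∑∑-fibres f w = begin
  ∑∑ (λ j i → w i * χ ⁅ f i ⁆ j)        ≡⟨ ∑-comm (λ j i → w i * χ ⁅ f i ⁆ j) ⟩
  ∑∑ (λ i j → w i * χ ⁅ f i ⁆ j)        ≡⟨ sum-cong-≗ (λ i → *-distribˡ-sum (w i) (χ ⁅ f i ⁆)) ⟨
  sum (λ i → w i * sum (χ ⁅ f i ⁆))     ≡⟨ sum-cong-≗ (λ i → trans (cong (w i *_) sum-χ⁅ f i ⁆) (*-identityʳ (w i))) ⟩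
  sum w                                 ∎
  where open ≡-Reasoning

χ*χ≤ : (A : Subset m) (B : Subset n) (i : Fin m) (j : Fin n) {k : ℕ} →
       (i ∈ A → j ∈ B → 1 ≤ k) → χ A i * χ B j ≤ k
χ*χ≤ A B i j 1≤k with lookup A i in eqA | lookup B j in eqB
... | true  | true  = 1≤k (lookup⇒[]= i A eqA) (lookup⇒[]= j B eqB)
... | true  | false = z≤n
... | false | _     = z≤n

x∈p─q⇒x∉q : (p q : Subset n) {x : Fin n} → x ∈ p Subset.─ q → x ∉ q
x∈p─q⇒x∉q (_ ∷ p) (true  ∷ q) (there x∈p─q) (there x∈q) = x∈p─q⇒x∉q p q x∈p─q x∈q
x∈p─q⇒x∉q (_ ∷ p) (false ∷ q) (there x∈p─q) (there x∈q) = x∈p─q⇒x∉q p q x∈p─q x∈q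

∣p∣≤∣p─q∣+∣q∣ : (A B : Subset n) → ∣ A ∣ ≤ ∣ A Subset.─ B ∣ + ∣ B ∣
∣p∣≤∣p─q∣+∣q∣ A B = begin
  ∣ A ∣                                       ≡⟨ sum-χ A ⟨
  sum (χ A)                                   ≤⟨ sum-mono-≤ _ _ pointwise ⟩
  sum (λ i → χ (A Subset.─ B) i + χ B i)      ≡⟨ ∑-distrib-+ (χ (A Subset.─ B)) (χ B) ⟩
  sum (χ (A Subset.─ B)) + sum (χ B)          ≡⟨ cong₂ _+_ (sum-χ (A Subset.─ B)) (sum-χ B) ⟩
  ∣ A Subset.─ B ∣ + ∣ B ∣                    ∎
  where
  open ≤-Reasoning
  pointwise : ∀ i → χ A i ≤ χ (A Subset.─ B) i + χ B i
  pointwise i with i ∈? A | i ∈? B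
  ... | no i∉A  | _       = subst (_≤ χ (A Subset.─ B) i + χ B i) (sym (χ-∉ A i i∉A)) z≤n
  ... | yes i∈A | yes i∈B = ≤-trans (χ≤1 A i)
    (≤-trans (≤-reflexive (sym (χ-∈ i∈B))) (m≤n+m (χ B i) (χ (A Subset.─ B) i)))
  ... | yes i∈A | no i∉B  = ≤-trans (χ≤1 A i)
    (≤-trans (≤-reflexive (sym (χ-∈ (x∈p∧x∉q⇒x∈p─q i∈A i∉B)))) (m≤m+n (χ (A Subset.─ B) i) (χ B i)))

-- Splitting `A` into the fibres of `f`, a fibre without a point of `A` contributes 0, and any other
-- one lies over a point of `B` and contributes at most 2. The second point `x′` may equal `x` or
-- lie outside `A`, since only an upper bound is wanted.
two-to-one : (f : Fin m → Fin n) (A : Subset m) (B : Subset n) →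
             (∀ {x} → x ∈ A → f x ∈ B) →
             (∀ {x} → x ∈ A → ∃[ x′ ] (∀ {y} → y ∈ A → f y ≡ f x → y ≡ x ⊎ y ≡ x′)) →
             ∣ A ∣ ≤ ∣ B ∣ * 2
two-to-one {m} f A B f∈B fibre = begin
  ∣ A ∣                             ≡⟨ sum-χ A ⟨
  sum (χ A)                         ≡⟨ ∑∑-fibres f (χ A) ⟨
  ∑∑ (λ j i → χ A i * χ ⁅ f i ⁆ j)  ≤⟨ sum-mono-≤ _ _ fibre-size ⟩
  sum (λ j → χ B j * 2)             ≡⟨ *-distribʳ-sum 2 (χ B) ⟨
  sum (χ B) * 2                     ≡⟨ cong (_* 2) (sum-χ B) ⟩
  ∣ B ∣ * 2                         ∎
  where
  open ≤-Reasoning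
  fibre-size : ∀ j → sum (λ i → χ A i * χ ⁅ f i ⁆ j) ≤ χ B j * 2
  fibre-size j with any? (λ x → x ∈? A ×-dec f x ≟ j)
  ... | no ∄x = begin
    sum (λ i → χ A i * χ ⁅ f i ⁆ j)  ≤⟨ sum-mono-≤ _ (λ _ → 0) (λ i → χ*χ≤ A ⁅ f i ⁆ i j λ i∈A j∈ →
                                          contradiction (i , i∈A , sym (x∈⁅y⁆⇒x≡y (f i) j∈)) ∄x) ⟩
    sum {m} (λ _ → 0)                ≡⟨ trans (sum-const m 0) (*-zeroʳ m) ⟩
    0                                ≤⟨ z≤n ⟩
    χ B j * 2                        ∎
  ... | yes (x , x∈A , refl) = begin
    sum (λ i → χ A i * χ ⁅ f i ⁆ (f x))   ≤⟨ sum-mono-≤ _ _ (λ i → χ*χ≤ A ⁅ f i ⁆ i (f x) (hit i)) ⟩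
    sum (λ i → χ ⁅ x ⁆ i + χ ⁅ x′ ⁆ i)    ≡⟨ ∑-distrib-+ (χ ⁅ x ⁆) (χ ⁅ x′ ⁆) ⟩
    sum (χ ⁅ x ⁆) + sum (χ ⁅ x′ ⁆)        ≡⟨ cong₂ _+_ sum-χ⁅ x ⁆ sum-χ⁅ x′ ⁆ ⟩
    1 * 2                                 ≡⟨ cong (_* 2) (χ-∈ (f∈B x∈A)) ⟨
    χ B (f x) * 2                         ∎
    where
    x′ = proj₁ (fibre x∈A)
    hit : ∀ i → i ∈ A → f x ∈ ⁅ f i ⁆ → 1 ≤ χ ⁅ x ⁆ i + χ ⁅ x′ ⁆ i
    hit i i∈A fx∈ with proj₂ (fibre x∈A) i∈A (sym (x∈⁅y⁆⇒x≡y (f i) fx∈))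
    ... | inj₁ refl = ≤-trans (≤-reflexive (sym (χ-∈ (x∈⁅x⁆ i)))) (m≤m+n (χ ⁅ i ⁆ i) _)
    ... | inj₂ refl = ≤-trans (≤-reflexive (sym (χ-∈ (x∈⁅x⁆ i)))) (m≤n+m (χ ⁅ i ⁆ i) (χ ⁅ x ⁆ i))

-- This is the expansion of (x - y)² with the cross term moved to the left, which lets the variance
-- be computed in ℕ.
∣-∣² : ∀ x y → ∣ x - y ∣ * ∣ x - y ∣ + 2 * (x * y) ≡ x * x + y * y
∣-∣² x y = [ below x y , (λ y≤x → begin
    ∣ x - y ∣ * ∣ x - y ∣ + 2 * (x * y)  ≡⟨ cong₂ _+_ (cong (λ d → d * d) (∣-∣-comm x y)) (cong (2 *_) (*-comm x y)) ⟩
    ∣ y - x ∣ * ∣ y - x ∣ + 2 * (y * x)  ≡⟨ below y x y≤x ⟩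
    y * y + x * x                        ≡⟨ +-comm (y * y) (x * x) ⟩
    x * x + y * y                        ∎) ]′ (≤-total x y)
  where
  open ≡-Reasoning
  expand : ∀ x d → d * d + 2 * (x * (x + d)) ≡ x * x + (x + d) * (x + d)
  expand = solve-∀
  below : ∀ x y → x ≤ y → ∣ x - y ∣ * ∣ x - y ∣ + 2 * (x * y) ≡ x * x + y * y
  below x y x≤y = begin
    ∣ x - y ∣ * ∣ x - y ∣ + 2 * (x * y)  ≡⟨ cong (λ d → d * d + 2 * (x * y)) (m≤n⇒∣m-n∣≡n∸m x≤y) ⟩
    (y ∸ x) * (y ∸ x) + 2 * (x * y)      ≡⟨ cong (λ v → (y ∸ x) * (y ∸ x) + 2 * (x * v)) (m+[n∸m]≡n x≤y) ⟨
    (y ∸ x) * (y ∸ x) + 2 * (x * (x + (y ∸ x))) ≡⟨ expand x (y ∸ x) ⟩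
    x * x + (x + (y ∸ x)) * (x + (y ∸ x)) ≡⟨ cong (λ v → x * x + v * v) (m+[n∸m]≡n x≤y) ⟩
    x * x + y * y                        ∎

-- Commutative rings on `Fin N`: permutations, units and the element 2.

record FinRing (N : ℕ) : Set where
  infix  8 ⊝_
  infixl 7 _⊗_
  infixl 6 _⊕_
  field
    _⊕_ _⊗_           : Fin N → Fin N → Fin N
    ⊝_                : Fin N → Fin N
    0ᴿ 1ᴿ             : Fin N
    isCommutativeRing : IsCommutativeRing _≡_ _⊕_ _⊗_ ⊝_ 0ᴿ 1ᴿ

module _ {N : ℕ} (R : FinRing N) where
  open FinRing R
  private
    K : CommutativeRing 0ℓ 0ℓ
    K = record { isCommutativeRing = isCommutativeRing }
    module K = CommutativeRing K

  open import Algebra.Properties.Ring K.ring using (-1*x≈-x; -‿involutive; -‿distribˡ-*; +-cancelˡ; +-cancelʳ)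
  open import Algebra.Properties.AbelianGroup K.+-abelianGroup using (inverseˡ-unique)
  open import Algebra.Solver.Ring.NaturalCoefficients.Default K.commutativeSemiring
    using (solve; _:=_; _:+_; _:*_)

  IsUnit : Fin N → Set
  IsUnit u = ∃[ v ] v ⊗ u ≡ 1ᴿ

  sq : Fin N → Fin N
  sq x = x ⊗ x

  x⊕[⊝x⊕y] : ∀ x y → x ⊕ (⊝ x ⊕ y) ≡ y
  x⊕[⊝x⊕y] x y = begin
    x ⊕ (⊝ x ⊕ y)  ≡⟨ K.+-assoc x (⊝ x) y ⟨
    (x ⊕ ⊝ x) ⊕ y  ≡⟨ cong (_⊕ y) (K.-‿inverseʳ x) ⟩
    0ᴿ ⊕ y         ≡⟨ K.+-identityˡ y ⟩
    y              ∎
    where open ≡-Reasoning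

  ⊝x⊕[x⊕y] : ∀ x y → ⊝ x ⊕ (x ⊕ y) ≡ y
  ⊝x⊕[x⊕y] x y = begin
    ⊝ x ⊕ (x ⊕ y)  ≡⟨ K.+-assoc (⊝ x) x y ⟨
    (⊝ x ⊕ x) ⊕ y  ≡⟨ cong (_⊕ y) (K.-‿inverseˡ x) ⟩
    0ᴿ ⊕ y         ≡⟨ K.+-identityˡ y ⟩
    y              ∎
    where open ≡-Reasoning

  unit-cancelˡ : ∀ {u v} → v ⊗ u ≡ 1ᴿ → ∀ x → v ⊗ (u ⊗ x) ≡ x
  unit-cancelˡ {u} {v} vu≡1 x = begin
    v ⊗ (u ⊗ x)  ≡⟨ K.*-assoc v u x ⟨
    (v ⊗ u) ⊗ x  ≡⟨ cong (_⊗ x) vu≡1 ⟩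
    1ᴿ ⊗ x       ≡⟨ K.*-identityˡ x ⟩
    x            ∎
    where open ≡-Reasoning

  translation : Fin N → Permutation′ N
  translation x = permutation (x ⊕_) (⊝ x ⊕_) (x⊕[⊝x⊕y] x) (⊝x⊕[x⊕y] x)

  negation : Permutation′ N
  negation = permutation ⊝_ ⊝_ -‿involutive -‿involutive

  dilation : ∀ {u} → IsUnit u → Permutation′ N
  dilation {u} (v , vu≡1) = permutation (u ⊗_) (v ⊗_)
    (unit-cancelˡ (trans (K.*-comm u v) vu≡1)) (unit-cancelˡ vu≡1)

  unit⇒nonZeroDivisor : ∀ {u x} → IsUnit u → u ⊗ x ≡ 0ᴿ → x ≡ 0ᴿ
  unit⇒nonZeroDivisor {u} {x} (v , vu≡1) ux≡0 = begin
    x            ≡⟨ unit-cancelˡ vu≡1 x ⟨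
    v ⊗ (u ⊗ x)  ≡⟨ cong (v ⊗_) ux≡0 ⟩
    v ⊗ 0ᴿ       ≡⟨ K.zeroʳ v ⟩
    0ᴿ           ∎
    where open ≡-Reasoning

  2⊗x : ∀ x → (1ᴿ ⊕ 1ᴿ) ⊗ x ≡ x ⊕ x
  2⊗x x = trans (K.distribʳ x 1ᴿ 1ᴿ) (cong₂ _⊕_ (K.*-identityˡ x) (K.*-identityˡ x))

  -- With d = y - x, the factor y + x is d + 2x. Substituting y = x + d and adding x² to both sides
  -- leaves an identity without subtraction, within reach of the semiring solver.
  difference-of-squares : ∀ {x y} → sq y ≡ sq x → (⊝ x ⊕ y) ⊗ ((⊝ x ⊕ y) ⊕ (x ⊕ x)) ≡ 0ᴿ
  difference-of-squares {x} {y} y²≡x² = +-cancelˡ (sq x) _ _ (begin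
    sq x ⊕ (⊝ x ⊕ y) ⊗ ((⊝ x ⊕ y) ⊕ (x ⊕ x))
      ≡⟨ solve 2 (λ x d → x :* x :+ d :* (d :+ (x :+ x)) := (x :+ d) :* (x :+ d)) refl x (⊝ x ⊕ y) ⟩
    sq (x ⊕ (⊝ x ⊕ y))
      ≡⟨ cong sq (x⊕[⊝x⊕y] x y) ⟩
    sq y
      ≡⟨ trans y²≡x² (sym (K.+-identityʳ (sq x))) ⟩
    sq x ⊕ 0ᴿ ∎)
    where open ≡-Reasoning

  open import Algebra.Properties.Semiring.Mult K.semiring using (×1-homo-*) renaming (_×_ to _·_)
  import Algebra.Properties.CommutativeMonoid.Sum K.+-commutativeMonoid as ∑ᴿ

  -- Translation by 1 permutes the ring, so it does not change the sum of all elements.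
  order·1≡0 : N · 1ᴿ ≡ 0ᴿ
  order·1≡0 = sym (+-cancelʳ (∑ᴿ.sum all) 0ᴿ (N · 1ᴿ) (begin
    0ᴿ ⊕ ∑ᴿ.sum all                  ≡⟨ K.+-identityˡ (∑ᴿ.sum all) ⟩
    ∑ᴿ.sum all                       ≡⟨ ∑ᴿ.sum-permute all (translation 1ᴿ) ⟩
    ∑ᴿ.sum (λ x → 1ᴿ ⊕ x)            ≡⟨ ∑ᴿ.∑-distrib-+ (λ _ → 1ᴿ) all ⟩
    ∑ᴿ.sum {N} (λ _ → 1ᴿ) ⊕ ∑ᴿ.sum all ≡⟨ cong (_⊕ ∑ᴿ.sum all) (∑ᴿ.sum-replicate N) ⟩
    N · 1ᴿ ⊕ ∑ᴿ.sum all              ∎))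
    where
    open ≡-Reasoning
    all : Fin N → Fin N
    all x = x

  -- The order N = 1 + 2k annihilates 1, so 2k = -1 in the ring and -k is an inverse of 2.
  odd⇒unit-2 : ∀ k → N ≡ 1 + k * 2 → IsUnit (1ᴿ ⊕ 1ᴿ)
  odd⇒unit-2 k N≡1+2k = ⊝ (k · 1ᴿ) , (begin
    ⊝ (k · 1ᴿ) ⊗ (1ᴿ ⊕ 1ᴿ)    ≡⟨ -‿distribˡ-* (k · 1ᴿ) (1ᴿ ⊕ 1ᴿ) ⟨
    ⊝ (k · 1ᴿ ⊗ (1ᴿ ⊕ 1ᴿ))    ≡⟨ inverseˡ-unique 1ᴿ (k · 1ᴿ ⊗ (1ᴿ ⊕ 1ᴿ)) 1+2k≡0 ⟨
    1ᴿ                        ∎)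
    where
    open ≡-Reasoning
    1+2k≡0 : 1ᴿ ⊕ k · 1ᴿ ⊗ (1ᴿ ⊕ 1ᴿ) ≡ 0ᴿ
    1+2k≡0 = begin
      -- The multiple `2 · 1ᴿ` unfolds to `1ᴿ ⊕ (1ᴿ ⊕ 0ᴿ)`, hence the extra zero.
      1ᴿ ⊕ k · 1ᴿ ⊗ (1ᴿ ⊕ 1ᴿ)  ≡⟨ cong (λ x → 1ᴿ ⊕ k · 1ᴿ ⊗ (1ᴿ ⊕ x)) (K.+-identityʳ 1ᴿ) ⟨
      1ᴿ ⊕ k · 1ᴿ ⊗ (2 · 1ᴿ)   ≡⟨ cong (1ᴿ ⊕_) (×1-homo-* k 2) ⟨
      (1 + k * 2) · 1ᴿ         ≡⟨ cong (_· 1ᴿ) N≡1+2k ⟨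
      N · 1ᴿ                   ≡⟨ order·1≡0 ⟩
      0ᴿ                       ∎

  -- Incidences between the points S × T and the parabolas t = (s + a)² + c.
  module _ (𝔪 : Subset N) (unit : ∀ x → x ∉ 𝔪 → IsUnit x) (unit-2 : IsUnit (1ᴿ ⊕ 1ᴿ))
           (S T : Subset N) where

    incidences : Fin N → Fin N → ℕ
    incidences a c = sum λ s → χ S s * χ T (sq (s ⊕ a) ⊕ c)

    -- For fixed a and s the map c ↦ (s + a)² + c permutes the ring, so it hits T exactly |T| times.
    -- Over the N² parabolas the mean is therefore |S||T| / N.
    sum-incidences : ∑∑ incidences ≡ N * (∣ S ∣ * ∣ T ∣)
    sum-incidences = trans (sum-cong-≗ column) (sum-const N _)
      where
      open ≡-Reasoning
      column : ∀ a → sum (incidences a) ≡ ∣ S ∣ * ∣ T ∣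
      column a = begin
        sum (incidences a)
          ≡⟨ ∑-comm (λ c s → χ S s * χ T (sq (s ⊕ a) ⊕ c)) ⟩
        ∑∑ (λ s c → χ S s * χ T (sq (s ⊕ a) ⊕ c))
          ≡⟨ sum-cong-≗ (λ s → *-distribˡ-sum (χ S s) (λ c → χ T (sq (s ⊕ a) ⊕ c))) ⟨
        sum (λ s → χ S s * sum (λ c → χ T (sq (s ⊕ a) ⊕ c)))
          ≡⟨ sum-cong-≗ (λ s → cong (χ S s *_) (trans (sum-reindex (translation (sq (s ⊕ a))) (χ T)) (sum-χ T))) ⟩
        sum (λ s → χ S s * ∣ T ∣)
          ≡⟨ *-distribʳ-sum ∣ T ∣ (χ S) ⟨
        sum (χ S) * ∣ T ∣
          ≡⟨ cong (_* ∣ T ∣) (sum-χ S) ⟩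
        ∣ S ∣ * ∣ T ∣ ∎

    -- The number of parabolas that meet T above both s and s + d. The second abscissa is given by
    -- its difference d from the first because the estimate depends only on whether d lies in `𝔪`.
    correlation : Fin N → Fin N → ℕ
    correlation s d = ∑∑ λ a c → χ T (sq (s ⊕ a) ⊕ c) * χ T (sq ((s ⊕ d) ⊕ a) ⊕ c)

    -- The square counts pairs of abscissae on a common parabola; the second one is rewritten as s +
    -- d.
    sum-incidences² : ∑∑ (λ a c → incidences a c * incidences a c)
                    ≡ ∑∑ (λ s d → χ S s * χ S (s ⊕ d) * correlation s d)
    sum-incidences² = begin
      ∑∑ (λ a c → incidences a c * incidences a c)
        ≡⟨ ∑∑-cong (λ a c → ∑∑-product (f a c) (f a c)) ⟨
      ∑∑ (λ a c → ∑∑ (λ s s′ → f a c s * f a c s′))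
        ≡⟨ ∑∑-cong (λ a c → sum-cong-≗ λ s → sum-reindex (translation s) (λ s′ → f a c s * f a c s′)) ⟨
      ∑∑ (λ a c → ∑∑ (λ s d → f a c s * f a c (s ⊕ d)))
        -- Four exchanges turn the order of summation a, c, s, d into s, d, a, c, after which the
        -- indicators of S are constant in the inner double sum.
        ≡⟨ sum-cong-≗ (λ a → ∑-comm (λ c s → sum λ d → f a c s * f a c (s ⊕ d))) ⟩
      ∑∑ (λ a s → ∑∑ (λ c d → f a c s * f a c (s ⊕ d)))
        ≡⟨ ∑∑-cong (λ a s → ∑-comm (λ c d → f a c s * f a c (s ⊕ d))) ⟩
      ∑∑ (λ a s → ∑∑ (λ d c → f a c s * f a c (s ⊕ d)))
        ≡⟨ ∑-comm (λ a s → ∑∑ (λ d c → f a c s * f a c (s ⊕ d))) ⟩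
      ∑∑ (λ s a → ∑∑ (λ d c → f a c s * f a c (s ⊕ d)))
        ≡⟨ sum-cong-≗ (λ s → ∑-comm (λ a d → sum λ c → f a c s * f a c (s ⊕ d))) ⟩
      ∑∑ (λ s d → ∑∑ (λ a c → f a c s * f a c (s ⊕ d)))
        ≡⟨ ∑∑-cong (λ s d → ∑∑-cong λ a c →
             [m*n]*[o*p]≡[m*o]*[n*p] (χ S s) (χ T (sq (s ⊕ a) ⊕ c)) (χ S (s ⊕ d)) (χ T (sq ((s ⊕ d) ⊕ a) ⊕ c))) ⟩
      ∑∑ (λ s d → ∑∑ (λ a c → χ S s * χ S (s ⊕ d) * (χ T (sq (s ⊕ a) ⊕ c) * χ T (sq ((s ⊕ d) ⊕ a) ⊕ c))))
        ≡⟨ ∑∑-cong (λ s d → ∑∑-*ˡ (χ S s * χ S (s ⊕ d)) λ a c → χ T (sq (s ⊕ a) ⊕ c) * χ T (sq ((s ⊕ d) ⊕ a) ⊕ c)) ⟩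
      ∑∑ (λ s d → χ S s * χ S (s ⊕ d) * correlation s d) ∎
      where
      open ≡-Reasoning
      f : Fin N → Fin N → Fin N → ℕ
      f a c s = χ S s * χ T (sq (s ⊕ a) ⊕ c)

    -- The gap (a + d)² - a² between two ordinates, where `a` stands for the translated parameter s
    -- + a. Doubling is written as a product with 1 + 1 so that it can be undone by a dilation.
    shift : Fin N → Fin N → Fin N
    shift d a = d ⊗ (d ⊕ (1ᴿ ⊕ 1ᴿ) ⊗ a)

    -- The new variables are t = (s + a)² + c, the first ordinate, and s + a in place of a. Both
    -- changes are translations, and afterwards s has disappeared.
    correlation-shift : ∀ s d → correlation s d ≡ ∑∑ λ t a → χ T t * χ T (t ⊕ shift d a)
    correlation-shift s d = begin
      ∑∑ (λ a c → χ T (sq (s ⊕ a) ⊕ c) * χ T (sq ((s ⊕ d) ⊕ a) ⊕ c))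
        ≡⟨ ∑∑-cong (λ a c → cong (λ t → χ T (sq (s ⊕ a) ⊕ c) * χ T t) (expand s d a c)) ⟩
      ∑∑ (λ a c → χ T (sq (s ⊕ a) ⊕ c) * χ T ((sq (s ⊕ a) ⊕ c) ⊕ shift d (s ⊕ a)))
        ≡⟨ sum-cong-≗ (λ a → sum-reindex (translation (sq (s ⊕ a))) (λ t → χ T t * χ T (t ⊕ shift d (s ⊕ a)))) ⟩
      ∑∑ (λ a t → χ T t * χ T (t ⊕ shift d (s ⊕ a)))
        ≡⟨ sum-reindex (translation s) (λ a → sum λ t → χ T t * χ T (t ⊕ shift d a)) ⟩
      ∑∑ (λ a t → χ T t * χ T (t ⊕ shift d a))
        ≡⟨ ∑-comm (λ a t → χ T t * χ T (t ⊕ shift d a)) ⟩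
      ∑∑ (λ t a → χ T t * χ T (t ⊕ shift d a)) ∎
      where
      open ≡-Reasoning
      expand : ∀ s d a c → sq ((s ⊕ d) ⊕ a) ⊕ c ≡ (sq (s ⊕ a) ⊕ c) ⊕ shift d (s ⊕ a)
      expand s d a c = trans
        (solve 4 (λ s d a c → ((s :+ d) :+ a) :* ((s :+ d) :+ a) :+ c
                    := (((s :+ a) :* (s :+ a)) :+ c) :+ d :* (d :+ ((s :+ a) :+ (s :+ a)))) refl s d a c)
        (cong (λ y → (sq (s ⊕ a) ⊕ c) ⊕ d ⊗ (d ⊕ y)) (sym (2⊗x (s ⊕ a))))

    -- For fixed t, the map a ↦ t + d (d + 2a) is a composition of permutations: doubling, adding d,
    -- multiplying by d and adding t. They are removed one at a time, until the second ordinate runs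
    -- over the ring independently of t.
    correlation-unit : ∀ s {d} → IsUnit d → correlation s d ≡ ∣ T ∣ * ∣ T ∣
    correlation-unit s {d} unit-d = begin
      correlation s d
        ≡⟨ correlation-shift s d ⟩
      ∑∑ (λ t a → χ T t * χ T (t ⊕ shift d a))
        ≡⟨ sum-cong-≗ (λ t → sum-reindex (dilation unit-2) (λ a → χ T t * χ T (t ⊕ d ⊗ (d ⊕ a)))) ⟩
      ∑∑ (λ t a → χ T t * χ T (t ⊕ d ⊗ (d ⊕ a)))
        ≡⟨ sum-cong-≗ (λ t → sum-reindex (translation d) (λ a → χ T t * χ T (t ⊕ d ⊗ a))) ⟩
      ∑∑ (λ t a → χ T t * χ T (t ⊕ d ⊗ a))
        ≡⟨ sum-cong-≗ (λ t → sum-reindex (dilation unit-d) (λ a → χ T t * χ T (t ⊕ a))) ⟩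
      ∑∑ (λ t a → χ T t * χ T (t ⊕ a))
        ≡⟨ sum-cong-≗ (λ t → sum-reindex (translation t) (λ a → χ T t * χ T a)) ⟩
      ∑∑ (λ t a → χ T t * χ T a)
        ≡⟨ ∑∑-product (χ T) (χ T) ⟩
      sum (χ T) * sum (χ T)
        ≡⟨ cong₂ _*_ (sum-χ T) (sum-χ T) ⟩
      ∣ T ∣ * ∣ T ∣ ∎
      where open ≡-Reasoning

    -- Second moment, variance and Chebyshev's inequality.

    private
      X M : ℕ
      X = ∣ S ∣ * ∣ T ∣
      M = ∣ 𝔪 ∣

    -- For d in `𝔪` the condition on the second ordinate is dropped, leaving |T| choices of t and N
    -- of a. Adding both bounds, the second weighted by `χ 𝔪 d`, avoids a case distinction in later
    -- sums.
    correlation-bound : ∀ s d → correlation s d ≤ ∣ T ∣ * ∣ T ∣ + χ 𝔪 d * (N * ∣ T ∣)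
    correlation-bound s d with d ∈? 𝔪
    ... | no d∉𝔪 = ≤-trans (≤-reflexive (correlation-unit s (unit d d∉𝔪))) (m≤m+n _ _)
    ... | yes d∈𝔪 = begin
      correlation s d                            ≡⟨ correlation-shift s d ⟩
      ∑∑ (λ t a → χ T t * χ T (t ⊕ shift d a))   ≤⟨ ∑∑-mono-≤ _ _ (λ t a → *-monoʳ-≤ (χ T t) (χ≤1 T (t ⊕ shift d a))) ⟩
      ∑∑ {N} {N} (λ t a → χ T t * 1)             ≡⟨ ∑∑-product {N} {N} (χ T) (λ _ → 1) ⟩
      sum (χ T) * sum {N} (λ _ → 1)              ≡⟨ cong₂ _*_ (sum-χ T) (trans (sum-const N 1) (*-identityʳ N)) ⟩
      ∣ T ∣ * N                                  ≡⟨ *-comm ∣ T ∣ N ⟩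
      N * ∣ T ∣                                  ≡⟨ *-identityˡ (N * ∣ T ∣) ⟨
      1 * (N * ∣ T ∣)                            ≡⟨ cong (_* (N * ∣ T ∣)) (χ-∈ d∈𝔪) ⟨
      χ 𝔪 d * (N * ∣ T ∣)                        ≤⟨ m≤n+m _ (∣ T ∣ * ∣ T ∣) ⟩
      ∣ T ∣ * ∣ T ∣ + χ 𝔪 d * (N * ∣ T ∣)        ∎
      where open ≤-Reasoning

    -- The term X² is what independence would give; X |𝔪| N pays for the pairs whose difference lies
    -- in `𝔪`.
    second-moment : ∑∑ (λ a c → incidences a c * incidences a c) ≤ X * X + X * (M * N)
    second-moment = begin
      ∑∑ (λ a c → incidences a c * incidences a c)
        ≡⟨ sum-incidences² ⟩
      ∑∑ (λ s d → χ S s * χ S (s ⊕ d) * correlation s d)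
        ≤⟨ ∑∑-mono-≤ _ _ (λ s d → *-monoʳ-≤ (χ S s * χ S (s ⊕ d)) (correlation-bound s d)) ⟩
      ∑∑ (λ s d → χ S s * χ S (s ⊕ d) * (∣ T ∣ * ∣ T ∣ + χ 𝔪 d * (N * ∣ T ∣)))
        ≤⟨ ∑∑-mono-≤ _ _ pointwise ⟩
      ∑∑ (λ s d → (∣ T ∣ * ∣ T ∣) * (χ S s * χ S (s ⊕ d)) + (N * ∣ T ∣) * (χ S s * χ 𝔪 d))
        ≡⟨ ∑∑-distrib-+ (λ s d → (∣ T ∣ * ∣ T ∣) * (χ S s * χ S (s ⊕ d))) (λ s d → (N * ∣ T ∣) * (χ S s * χ 𝔪 d)) ⟩
      ∑∑ (λ s d → (∣ T ∣ * ∣ T ∣) * (χ S s * χ S (s ⊕ d))) + ∑∑ (λ s d → (N * ∣ T ∣) * (χ S s * χ 𝔪 d))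
        ≡⟨ cong₂ _+_ (∑∑-*ˡ (∣ T ∣ * ∣ T ∣) (λ s d → χ S s * χ S (s ⊕ d)))
                     (∑∑-*ˡ (N * ∣ T ∣) (λ s d → χ S s * χ 𝔪 d)) ⟩
      (∣ T ∣ * ∣ T ∣) * ∑∑ (λ s d → χ S s * χ S (s ⊕ d)) + (N * ∣ T ∣) * ∑∑ (λ s d → χ S s * χ 𝔪 d)
        ≡⟨ cong₂ (λ u v → (∣ T ∣ * ∣ T ∣) * u + (N * ∣ T ∣) * v) pairs
             (trans (∑∑-product (χ S) (χ 𝔪)) (cong₂ _*_ (sum-χ S) (sum-χ 𝔪))) ⟩
      (∣ T ∣ * ∣ T ∣) * (∣ S ∣ * ∣ S ∣) + (N * ∣ T ∣) * (∣ S ∣ * M)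
        ≡⟨ collect ∣ S ∣ ∣ T ∣ M N ⟩
      X * X + X * (M * N) ∎
      where
      open ≤-Reasoning
      pairs : ∑∑ (λ s d → χ S s * χ S (s ⊕ d)) ≡ ∣ S ∣ * ∣ S ∣
      pairs = trans (sum-cong-≗ λ s → sum-reindex (translation s) (λ s′ → χ S s * χ S s′))
                    (trans (∑∑-product (χ S) (χ S)) (cong₂ _*_ (sum-χ S) (sum-χ S)))
      collect : ∀ s t m n → (t * t) * (s * s) + (n * t) * (s * m) ≡ (s * t) * (s * t) + (s * t) * (m * n)
      collect = solve-∀
      split : ∀ u v t m w → u * v * (t + m * w) ≡ t * (u * v) + w * (u * m) * v
      split = solve-∀
      pointwise : ∀ s d → χ S s * χ S (s ⊕ d) * (∣ T ∣ * ∣ T ∣ + χ 𝔪 d * (N * ∣ T ∣))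
                ≤ (∣ T ∣ * ∣ T ∣) * (χ S s * χ S (s ⊕ d)) + (N * ∣ T ∣) * (χ S s * χ 𝔪 d)
      pointwise s d = begin
        χ S s * χ S (s ⊕ d) * (∣ T ∣ * ∣ T ∣ + χ 𝔪 d * (N * ∣ T ∣))
          ≡⟨ split (χ S s) (χ S (s ⊕ d)) (∣ T ∣ * ∣ T ∣) (χ 𝔪 d) (N * ∣ T ∣) ⟩
        (∣ T ∣ * ∣ T ∣) * (χ S s * χ S (s ⊕ d)) + (N * ∣ T ∣) * (χ S s * χ 𝔪 d) * χ S (s ⊕ d)
          -- The condition s + d ∈ S is dropped in the error term only; the main term keeps it, so
          -- as to sum to |S|² |T|² exactly.
          ≤⟨ +-monoʳ-≤ ((∣ T ∣ * ∣ T ∣) * (χ S s * χ S (s ⊕ d)))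
               (*-monoʳ-≤ ((N * ∣ T ∣) * (χ S s * χ 𝔪 d)) (χ≤1 S (s ⊕ d))) ⟩
        (∣ T ∣ * ∣ T ∣) * (χ S s * χ S (s ⊕ d)) + (N * ∣ T ∣) * (χ S s * χ 𝔪 d) * 1
          ≡⟨ cong ((∣ T ∣ * ∣ T ∣) * (χ S s * χ S (s ⊕ d)) +_) (*-identityʳ _) ⟩
        (∣ T ∣ * ∣ T ∣) * (χ S s * χ S (s ⊕ d)) + (N * ∣ T ∣) * (χ S s * χ 𝔪 d) ∎

    -- N times the deviation of the number of incidences from its mean X / N.
    deviation : Fin N → Fin N → ℕ
    deviation a c = ∣ N * incidences a c - X ∣

    variance : ∑∑ (λ a c → deviation a c * deviation a c) ≤ (N * N) * (X * (M * N))
    -- The amount added to both sides is the total of the cross terms 2 (N I) X, where I is the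
    -- number of incidences; it is known from the first moment. On the right it is matched by the X²
    -- of the second moment and the X² from expanding the square.
    variance = +-cancelʳ-≤ (2 * ((N * N) * (X * X))) _ _ (begin
      ∑∑ D² + 2 * ((N * N) * (X * X))
        ≡⟨ cong (∑∑ D² +_) mixed ⟨
      ∑∑ D² + ∑∑ (λ a c → 2 * ((N * incidences a c) * X))
        ≡⟨ ∑∑-distrib-+ D² (λ a c → 2 * ((N * incidences a c) * X)) ⟨
      ∑∑ (λ a c → D² a c + 2 * ((N * incidences a c) * X))
        ≡⟨ ∑∑-cong (λ a c → ∣-∣² (N * incidences a c) X) ⟩
      ∑∑ (λ a c → (N * incidences a c) * (N * incidences a c) + X * X)
        ≡⟨ ∑∑-distrib-+ (λ a c → (N * incidences a c) * (N * incidences a c)) (λ _ _ → X * X) ⟩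
      ∑∑ (λ a c → (N * incidences a c) * (N * incidences a c)) + ∑∑ {N} {N} (λ _ _ → X * X)
        ≡⟨ cong₂ _+_ squared (∑∑-const N N (X * X)) ⟩
      (N * N) * ∑∑ (λ a c → incidences a c * incidences a c) + N * (N * (X * X))
        ≤⟨ +-monoˡ-≤ _ (*-monoʳ-≤ (N * N) second-moment) ⟩
      (N * N) * (X * X + X * (M * N)) + N * (N * (X * X))
        ≡⟨ collect N X (X * (M * N)) ⟩
      (N * N) * (X * (M * N)) + 2 * ((N * N) * (X * X)) ∎)
      where
      open ≤-Reasoning
      D² : Fin N → Fin N → ℕ
      D² a c = deviation a c * deviation a c
      collect : ∀ n x y → (n * n) * (x * x + y) + n * (n * (x * x)) ≡ (n * n) * y + 2 * ((n * n) * (x * x))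
      collect = solve-∀
      assoc : ∀ n x i → 2 * ((n * i) * x) ≡ 2 * (n * x) * i
      assoc = solve-∀
      mean : ∀ n x → 2 * (n * x) * (n * x) ≡ 2 * ((n * n) * (x * x))
      mean = solve-∀
      mixed : ∑∑ (λ a c → 2 * ((N * incidences a c) * X)) ≡ 2 * ((N * N) * (X * X))
      mixed = trans (∑∑-cong λ a c → assoc N X (incidences a c))
              (trans (∑∑-*ˡ (2 * (N * X)) incidences)
              (trans (cong (2 * (N * X) *_) sum-incidences) (mean N X)))
      squared : ∑∑ (λ a c → (N * incidences a c) * (N * incidences a c))
              ≡ (N * N) * ∑∑ (λ a c → incidences a c * incidences a c)
      squared = trans (∑∑-cong λ a c → [m*n]*[o*p]≡[m*o]*[n*p] N (incidences a c) N (incidences a c))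
                      (∑∑-*ˡ (N * N) (λ a c → incidences a c * incidences a c))

    -- Here n is at least twice the mean X / N, so a parabola with n or more incidences deviates
    -- from the mean by at least n / 2. Each of the |A||Q| parabolas thus contributes at least n² /
    -- 4 to the variance, whence the factor 4.
    chebyshev : (A Q : Subset N) (n : ℕ) →
                (∀ a c → a ∈ A → c ∈ Q → n ≤ incidences (⊝ a) c) →
                2 * X ≤ N * n →
                ∣ A ∣ * ∣ Q ∣ * (n * n) ≤ 4 * (X * (M * N))
    chebyshev A Q n rich 2X≤Nn = *-cancelˡ-≤ (N * N) (begin
      (N * N) * (∣ A ∣ * ∣ Q ∣ * (n * n))
        ≡⟨ rearrange N (∣ A ∣ * ∣ Q ∣) n ⟩
      (N * n) * (N * n) * (∣ A ∣ * ∣ Q ∣)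
        ≡⟨ cong ((N * n) * (N * n) *_) (cong₂ _*_ (sum-χ A) (sum-χ Q)) ⟨
      (N * n) * (N * n) * (sum (χ A) * sum (χ Q))
        ≡⟨ cong ((N * n) * (N * n) *_) (∑∑-product (χ A) (χ Q)) ⟨
      (N * n) * (N * n) * ∑∑ (λ a c → χ A a * χ Q c)
        ≡⟨ ∑∑-*ˡ ((N * n) * (N * n)) (λ a c → χ A a * χ Q c) ⟨
      ∑∑ (λ a c → (N * n) * (N * n) * (χ A a * χ Q c))
        ≤⟨ ∑∑-mono-≤ _ _ pointwise ⟩
      ∑∑ (λ a c → 4 * (deviation (⊝ a) c * deviation (⊝ a) c))
        -- The parabolas are written with s + a, so those attached to `A` have parameter -a;
        -- negation permutes the parameters.
        ≡⟨ sum-reindex negation (λ a → sum λ c → 4 * (deviation a c * deviation a c)) ⟩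
      ∑∑ (λ a c → 4 * (deviation a c * deviation a c))
        ≡⟨ ∑∑-*ˡ 4 (λ a c → deviation a c * deviation a c) ⟩
      4 * ∑∑ (λ a c → deviation a c * deviation a c)
        ≤⟨ *-monoʳ-≤ 4 variance ⟩
      4 * ((N * N) * (X * (M * N)))
        ≡⟨ swap 4 (N * N) (X * (M * N)) ⟩
      (N * N) * (4 * (X * (M * N))) ∎)
      where
      open ≤-Reasoning
      instance
        N≢0 : NonZero N
        N≢0 = nonZeroIndex 0ᴿ
        N²≢0 : NonZero (N * N)
        N²≢0 = m*n≢0 N N
      swap : ∀ k m x → k * (m * x) ≡ m * (k * x)
      swap = solve-∀
      rearrange : ∀ N k n → (N * N) * (k * (n * n)) ≡ (N * n) * (N * n) * k
      rearrange = solve-∀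
      double : ∀ d → (2 * d) * (2 * d) ≡ 4 * (d * d)
      double = solve-∀
      -- One copy of N n is added to both sides, because 2 X ≤ N n absorbs exactly one of the two
      -- copies of N n.
      far : ∀ a c → a ∈ A → c ∈ Q → N * n ≤ 2 * deviation (⊝ a) c
      far a c a∈A c∈Q = +-cancelˡ-≤ (N * n) _ _ (begin
        N * n + N * n              ≡⟨ cong (N * n +_) (+-identityʳ (N * n)) ⟨
        2 * (N * n)                ≤⟨ *-monoʳ-≤ 2 (*-monoʳ-≤ N (rich a c a∈A c∈Q)) ⟩
        2 * (N * i)                ≤⟨ *-monoʳ-≤ 2 (m≤n+∣m-n∣ (N * i) X) ⟩
        2 * (X + ∣ N * i - X ∣)    ≡⟨ *-distribˡ-+ 2 X ∣ N * i - X ∣ ⟩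
        2 * X + 2 * ∣ N * i - X ∣  ≤⟨ +-monoˡ-≤ _ 2X≤Nn ⟩
        N * n + 2 * ∣ N * i - X ∣  ∎)
        where
        i = incidences (⊝ a) c
      pointwise : ∀ a c → (N * n) * (N * n) * (χ A a * χ Q c) ≤ 4 * (deviation (⊝ a) c * deviation (⊝ a) c)
      pointwise a c with a ∈? A | c ∈? Q
      ... | no a∉A | _ = ≤-trans (≤-reflexive (trans
        (cong (λ x → (N * n) * (N * n) * (x * χ Q c)) (χ-∉ A a a∉A)) (*-zeroʳ ((N * n) * (N * n))))) z≤n
      ... | yes _ | no c∉Q = ≤-trans (≤-reflexive (trans
        (cong ((N * n) * (N * n) *_) (trans (cong (χ A a *_) (χ-∉ Q c c∉Q)) (*-zeroʳ (χ A a))))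
        (*-zeroʳ ((N * n) * (N * n))))) z≤n
      ... | yes a∈A | yes c∈Q = begin
        (N * n) * (N * n) * (χ A a * χ Q c)   ≡⟨ cong₂ (λ x y → (N * n) * (N * n) * (x * y)) (χ-∈ a∈A) (χ-∈ c∈Q) ⟩
        (N * n) * (N * n) * 1                 ≡⟨ *-identityʳ ((N * n) * (N * n)) ⟩
        (N * n) * (N * n)                     ≤⟨ *-mono-≤ (far a c a∈A c∈Q) (far a c a∈A c∈Q) ⟩
        (2 * D) * (2 * D)                     ≡⟨ double D ⟩
        4 * (D * D)                           ∎
        where
        D = deviation (⊝ a) c

    -- The points (a + x, x² + c) with x in `A` lie on this parabola, and their abscissae are
    -- distinct because translation by a permutes the ring.
    incidences-rich : (A Q : Subset N) →
                      (∀ {a x} → a ∈ A → x ∈ A → a ⊕ x ∈ S) →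
                      (∀ {x c} → x ∈ A → c ∈ Q → sq x ⊕ c ∈ T) →
                      ∀ a c → a ∈ A → c ∈ Q → ∣ A ∣ ≤ incidences (⊝ a) c
    incidences-rich A Q ⊕∈S ⊕∈T a c a∈A c∈Q = begin
      ∣ A ∣
        ≡⟨ sum-χ A ⟨
      sum (χ A)
        ≤⟨ sum-mono-≤ _ _ pointwise ⟩
      sum (λ x → χ S (a ⊕ x) * χ T (sq ((a ⊕ x) ⊕ ⊝ a) ⊕ c))
        ≡⟨ sum-reindex (translation a) (λ s → χ S s * χ T (sq (s ⊕ ⊝ a) ⊕ c)) ⟩
      incidences (⊝ a) c ∎
      where
      open ≤-Reasoning
      a⊕x⊖a : ∀ x → (a ⊕ x) ⊕ ⊝ a ≡ x
      a⊕x⊖a x = trans (K.+-comm (a ⊕ x) (⊝ a)) (⊝x⊕[x⊕y] a x)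
      pointwise : ∀ x → χ A x ≤ χ S (a ⊕ x) * χ T (sq ((a ⊕ x) ⊕ ⊝ a) ⊕ c)
      pointwise x with x ∈? A
      ... | no x∉A  = subst (_≤ χ S (a ⊕ x) * χ T (sq ((a ⊕ x) ⊕ ⊝ a) ⊕ c)) (sym (χ-∉ A x x∉A)) z≤n
      ... | yes x∈A = subst (χ A x ≤_)
        (sym (cong₂ _*_ (χ-∈ (⊕∈S a∈A x∈A))
          (trans (cong (λ y → χ T (sq y ⊕ c)) (a⊕x⊖a x)) (χ-∈ (⊕∈T x∈A c∈Q)))))
        (χ≤1 A x)

  -- Squaring outside the ideal, and the sum-square dichotomy.

  module _ (𝔪 : Subset N)
           (+-closed : ∀ {x y} → x ∈ 𝔪 → y ∈ 𝔪 → x ⊕ y ∈ 𝔪)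
           (*-closed : ∀ x {y} → y ∈ 𝔪 → x ⊗ y ∈ 𝔪)
           (unit : ∀ x → x ∉ 𝔪 → IsUnit x) (unit-2 : IsUnit (1ᴿ ⊕ 1ᴿ)) where

    -- The factors d = y - x and e = y + x have product 0. They cannot both lie in `𝔪`, so one is a
    -- unit and the other vanishes.
    sq-two-to-one : ∀ {x y} → x ∉ 𝔪 → sq y ≡ sq x → y ≡ x ⊎ y ≡ ⊝ x
    sq-two-to-one {x} {y} x∉𝔪 y²≡x² with (⊝ x ⊕ y) ∈? 𝔪 | ((⊝ x ⊕ y) ⊕ (x ⊕ x)) ∈? 𝔪
    ... | no d∉𝔪  | _        = inj₂ (inverseˡ-unique y x (begin
      y ⊕ x                     ≡⟨ cong (_⊕ x) (x⊕[⊝x⊕y] x y) ⟨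
      (x ⊕ (⊝ x ⊕ y)) ⊕ x       ≡⟨ solve 2 (λ x d → (x :+ d) :+ x := d :+ (x :+ x)) refl x (⊝ x ⊕ y) ⟩
      (⊝ x ⊕ y) ⊕ (x ⊕ x)       ≡⟨ unit⇒nonZeroDivisor (unit _ d∉𝔪) (difference-of-squares y²≡x²) ⟩
      0ᴿ                        ∎))
      where open ≡-Reasoning
    ... | yes _   | no e∉𝔪   = inj₁ (begin
      y                         ≡⟨ x⊕[⊝x⊕y] x y ⟨
      x ⊕ (⊝ x ⊕ y)             ≡⟨ cong (x ⊕_) (unit⇒nonZeroDivisor (unit _ e∉𝔪)
                                     (trans (K.*-comm _ _) (difference-of-squares y²≡x²))) ⟩
      x ⊕ 0ᴿ                    ≡⟨ K.+-identityʳ x ⟩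
      x                         ∎)
      where open ≡-Reasoning
    ... | yes d∈𝔪 | yes e∈𝔪  = contradiction x∈𝔪 x∉𝔪
      where
      x∈𝔪 : x ∈ 𝔪
      -- Here 2x = e - d, and 2 is invertible.
      x∈𝔪 = subst (_∈ 𝔪) (unit-cancelˡ (proj₂ unit-2) x) (*-closed (proj₁ unit-2)
        (subst (_∈ 𝔪) (trans (⊝x⊕[x⊕y] (⊝ x ⊕ y) (x ⊕ x)) (sym (2⊗x x)))
          (+-closed (subst (_∈ 𝔪) (-1*x≈-x (⊝ x ⊕ y)) (*-closed (⊝ 1ᴿ) d∈𝔪)) e∈𝔪)))

    -- Doubling the count gives 2|A| ≤ 4|Q| + 2|𝔪| ≤ 4|Q| + |A|, from which one |A| is cancelled.
    ∣A∣≤4∣A²∣ : (A Q : Subset N) → (∀ {x} → x ∈ A → sq x ∈ Q) → 2 * ∣ 𝔪 ∣ ≤ ∣ A ∣ → ∣ A ∣ ≤ 4 * ∣ Q ∣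
    ∣A∣≤4∣A²∣ A Q sq∈Q 2∣𝔪∣≤∣A∣ = +-cancelʳ-≤ ∣ A ∣ _ _ (begin
      ∣ A ∣ + ∣ A ∣                    ≡⟨ cong (∣ A ∣ +_) (+-identityʳ ∣ A ∣) ⟨
      2 * ∣ A ∣                        ≤⟨ *-monoʳ-≤ 2 (∣p∣≤∣p─q∣+∣q∣ A 𝔪) ⟩
      2 * (∣ A Subset.─ 𝔪 ∣ + ∣ 𝔪 ∣)   ≤⟨ *-monoʳ-≤ 2 (+-monoˡ-≤ ∣ 𝔪 ∣ squares) ⟩
      2 * (∣ Q ∣ * 2 + ∣ 𝔪 ∣)          ≡⟨ distribute ∣ Q ∣ ∣ 𝔪 ∣ ⟩
      4 * ∣ Q ∣ + 2 * ∣ 𝔪 ∣            ≤⟨ +-monoʳ-≤ (4 * ∣ Q ∣) 2∣𝔪∣≤∣A∣ ⟩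
      4 * ∣ Q ∣ + ∣ A ∣                ∎)
      where
      open ≤-Reasoning
      distribute : ∀ q m → 2 * (q * 2 + m) ≡ 4 * q + 2 * m
      distribute = solve-∀
      squares : ∣ A Subset.─ 𝔪 ∣ ≤ ∣ Q ∣ * 2
      squares = two-to-one sq (A Subset.─ 𝔪) Q (λ x∈ → sq∈Q (p─q⊆p A 𝔪 x∈))
        λ {x} x∈ → ⊝ x , λ _ y²≡x² → sq-two-to-one (x∈p─q⇒x∉q A 𝔪 x∈) y²≡x²

    sum-square-dichotomy :
      (A S Q T : Subset N) →
      (∀ {x y} → x ∈ A → y ∈ A → x ⊕ y ∈ S) →
      (∀ {x} → x ∈ A → sq x ∈ Q) →
      (∀ {x y} → x ∈ Q → y ∈ Q → x ⊕ y ∈ T) →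
      2 * ∣ 𝔪 ∣ ≤ ∣ A ∣ →
      N * ∣ A ∣ ≤ 16 * (∣ S ∣ * ∣ T ∣) ⊎ ∣ A ∣ ^ 4 ≤ 16 * (∣ S ∣ * ∣ T ∣ * (∣ 𝔪 ∣ * N))
    sum-square-dichotomy A S Q T ⊕∈S sq∈Q ⊕∈T 2∣𝔪∣≤∣A∣ with ≤-total (2 * (∣ S ∣ * ∣ T ∣)) (N * ∣ A ∣)
    -- The constant 2 is weakened to 16 so that both alternatives share one constant.
    ... | inj₂ N∣A∣≤2X = inj₁ (≤-trans N∣A∣≤2X (*-monoˡ-≤ (∣ S ∣ * ∣ T ∣) (m≤m+n 2 14)))
    ... | inj₁ 2X≤N∣A∣ = inj₂ (begin
      ∣ A ∣ ^ 4                                ≡⟨ fourth ∣ A ∣ ⟩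
      -- One factor |A| is traded for 4|Q|, since Chebyshev's inequality bounds |A||Q||A|². This 4
      -- and the one in that inequality make 16.
      ∣ A ∣ * ∣ A ∣ * (∣ A ∣ * ∣ A ∣)          ≤⟨ *-monoˡ-≤ (∣ A ∣ * ∣ A ∣) (*-monoʳ-≤ ∣ A ∣
                                                    (∣A∣≤4∣A²∣ A Q sq∈Q 2∣𝔪∣≤∣A∣)) ⟩
      ∣ A ∣ * (4 * ∣ Q ∣) * (∣ A ∣ * ∣ A ∣)    ≡⟨ pull ∣ A ∣ ∣ Q ∣ (∣ A ∣ * ∣ A ∣) ⟩
      4 * (∣ A ∣ * ∣ Q ∣ * (∣ A ∣ * ∣ A ∣))    ≤⟨ *-monoʳ-≤ 4 (chebyshev 𝔪 unit unit-2 S T A Q ∣ A ∣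
                                                    (incidences-rich 𝔪 unit unit-2 S T A Q ⊕∈S (λ x∈A → ⊕∈T (sq∈Q x∈A)))
                                                    2X≤N∣A∣) ⟩
      4 * (4 * (∣ S ∣ * ∣ T ∣ * (∣ 𝔪 ∣ * N)))  ≡⟨ *-assoc 4 4 (∣ S ∣ * ∣ T ∣ * (∣ 𝔪 ∣ * N)) ⟨
      16 * (∣ S ∣ * ∣ T ∣ * (∣ 𝔪 ∣ * N))       ∎)
      where
      open ≤-Reasoning
      fourth : ∀ a → a * (a * (a * (a * 1))) ≡ a * a * (a * a)
      fourth = solve-∀
      pull : ∀ a q b → a * (4 * q) * b ≡ 4 * (a * q * b)
      pull = solve-∀

-- Membership in comprehensions, and transport of the ring to indices.

∈-comprehension⁺ : ∀ {p} {P : Pred (Fin n) p} (P? : Decidable P) {i : Fin n} → P i → i ∈ comprehension P?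
∈-comprehension⁺ P? {i} Pi =
  lookup⇒[]= i (comprehension P?) (trans (lookup∘tabulate (does ∘ P?) i) (dec-true (P? i) Pi))

∈-comprehension⁻ : ∀ {p} {P : Pred (Fin n) p} (P? : Decidable P) {i : Fin n} → i ∈ comprehension P? → P i
∈-comprehension⁻ P? {i} i∈ with P? i | trans (sym (lookup∘tabulate (does ∘ P?) i)) ([]=⇒lookup i∈)
... | yes Pi | _ = Pi

module _ {c ℓ} (F : FiniteCommutativeRing c ℓ) where
  private
    module F = FiniteCommutativeRing F
  open F using (Carrier; _≈_; index; element; order)

  element-index : ∀ x → element (index x) ≈ x
  element-index = Inverse.strictlyInverseʳ F.enumeration

  index-element : ∀ i → index (element i) ≡ i
  index-element = Inverse.strictlyInverseˡ F.enumeration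

  index-cong : ∀ {x y} → x ≈ y → index x ≡ index y
  index-cong = Inverse.to-cong F.enumeration

  index-injective : ∀ {x y} → index x ≡ index y → x ≈ y
  index-injective {x} {y} eq = F.trans (F.sym (element-index x))
    (F.trans (F.reflexive (cong element eq)) (element-index y))

  ∈-resp-≈ : ∀ (A : F.𝒫) {x y} → x ≈ y → x F.∈ A → y F.∈ A
  ∈-resp-≈ A x≈y = subst (_∈ A) (index-cong x≈y)

  private
    rawRing : RawRing 0ℓ 0ℓ
    rawRing = record
      { Carrier = Fin order
      ; _≈_     = _≡_
      ; _+_     = λ i j → index (element i F.+ element j)
      ; _*_     = λ i j → index (element i F.* element j)
      ; -_      = λ i → index (F.- element i)
      ; 0#      = index F.0#
      ; 1#      = index F.1#
      }

    isRingMonomorphism : IsRingMonomorphism rawRing F.rawRing element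
    isRingMonomorphism = record
      { isRingHomomorphism = record
        { isSemiringHomomorphism = record
          { isNearSemiringHomomorphism = record
            { +-isMonoidHomomorphism = record
              { isMagmaHomomorphism = record
                { isRelHomomorphism = record { cong = λ eq → F.reflexive (cong element eq) }
                ; homo = λ i j → element-index (element i F.+ element j)
                }
              ; ε-homo = element-index F.0#
              }
            ; *-homo = λ i j → element-index (element i F.* element j)
            }
          ; 1#-homo = element-index F.1#
          }
        ; -‿homo = λ i → element-index (F.- element i)
        }
      ; injective = λ {i} {j} eq → trans (sym (index-element i)) (trans (index-cong eq) (index-element j))
      }

  -- The axioms are pulled back along the injective homomorphism `element`. The operations are
  -- literally those used in the definitions of sumset and set of squares, so membership transfers
  -- by `refl`.
  finRing : FinRing order
  finRing = record
    { isCommutativeRing = RingMonomorphism.isCommutativeRing isRingMonomorphism F.isCommutativeRing }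

  -- Ideals, units and the size of the maximal ideal.

  -- A geometric series inverts wx = 1 - t: the witness is v = w (1 + t + ... + t^(r-1)), built one
  -- term at a time while keeping vx + t^k = 1.
  complement-of-nilpotent : ∀ {w x t} r → w F.* x F.+ t ≈ F.1# → t F.^ʳ r ≈ F.0# → ∃[ v ] v F.* x ≈ F.1#
  complement-of-nilpotent {w} {x} {t} r wx+t≈1 tʳ≈0 with power r
    where
    open import Algebra.Solver.Ring.NaturalCoefficients.Default F.commutativeSemiring
      using (solve; _:=_; _:+_; _:*_)
    open import Relation.Binary.Reasoning.Setoid F.setoid
    power : ∀ k → ∃[ v ] v F.* x F.+ t F.^ʳ k ≈ F.1#
    power zero    = F.0# , F.trans (F.+-congʳ (F.zeroˡ x)) (F.+-identityˡ F.1#)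
    power (suc k) = let v , eq = power k ; tᵏ = t F.^ʳ k in v F.+ tᵏ F.* w , (begin
      (v F.+ tᵏ F.* w) F.* x F.+ t F.* tᵏ
        ≈⟨ solve 5 (λ v u w x t → (v :+ u :* w) :* x :+ t :* u := v :* x :+ u :* (w :* x :+ t)) F.refl v tᵏ w x t ⟩
      v F.* x F.+ tᵏ F.* (w F.* x F.+ t)
        ≈⟨ F.+-congˡ (F.trans (F.*-congˡ wx+t≈1) (F.*-identityʳ tᵏ)) ⟩
      v F.* x F.+ tᵏ
        ≈⟨ eq ⟩
      F.1# ∎)
  ... | v , eq = v , F.trans (F.sym (F.trans (F.+-congˡ tʳ≈0) (F.+-identityʳ (v F.* x)))) eq

  combination? : ∀ x y → Decidable λ k → ∃[ i ] ∃[ j ] k ≡ index (element i F.* x F.+ element j F.* y)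
  combination? x y k = any? λ i → any? λ j → k ≟ index (element i F.* x F.+ element j F.* y)

  -- This is the decision procedure inside the definition of a principal ideal, named so that
  -- membership there can be unpacked.
  multiple? : ∀ x → Decidable λ k → ∃[ i ] k ≡ index (element i F.* x)
  multiple? x k = any? λ i → k ≟ index (element i F.* x)

  ⟨_,_⟩ : Carrier → Carrier → F.𝒫
  ⟨ x , y ⟩ = comprehension (combination? x y)

  module _ (x y : Carrier) where
    ∈⟨,⟩⁺ : ∀ u v → u F.* x F.+ v F.* y F.∈ ⟨ x , y ⟩
    ∈⟨,⟩⁺ u v = ∈-comprehension⁺ (combination? x y) (index u , index v , index-cong
      (F.sym (F.+-cong (F.*-congʳ (element-index u)) (F.*-congʳ (element-index v)))))

    ∈⟨,⟩⁻ : ∀ {w} → w F.∈ ⟨ x , y ⟩ → ∃[ u ] ∃[ v ] w ≈ u F.* x F.+ v F.* y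
    ∈⟨,⟩⁻ w∈ with ∈-comprehension⁻ (combination? x y) w∈
    ... | i , j , eq = element i , element j , index-injective eq

    ⟨,⟩-isIdeal : F.IsIdeal ⟨ x , y ⟩
    ⟨,⟩-isIdeal = record
      { 0∈       = ∈-resp-≈ ⟨ x , y ⟩
          (F.trans (F.+-cong (F.zeroˡ x) (F.zeroˡ y)) (F.+-identityʳ F.0#)) (∈⟨,⟩⁺ F.0# F.0#)
      ; +-closed = λ a∈ b∈ → let u , v , eq = ∈⟨,⟩⁻ a∈ ; u′ , v′ , eq′ = ∈⟨,⟩⁻ b∈ in
          ∈-resp-≈ ⟨ x , y ⟩ (F.trans
            (solve 6 (λ u v u′ v′ x y → (u :+ u′) :* x :+ (v :+ v′) :* y
                        := (u :* x :+ v :* y) :+ (u′ :* x :+ v′ :* y)) F.refl u v u′ v′ x y)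
            (F.sym (F.+-cong eq eq′))) (∈⟨,⟩⁺ (u F.+ u′) (v F.+ v′))
      ; *-closed = λ w a∈ → let u , v , eq = ∈⟨,⟩⁻ a∈ in
          ∈-resp-≈ ⟨ x , y ⟩ (F.trans
            (solve 5 (λ w u v x y → (w :* u) :* x :+ (w :* v) :* y := w :* (u :* x :+ v :* y)) F.refl w u v x y)
            (F.sym (F.*-congˡ eq))) (∈⟨,⟩⁺ (w F.* u) (w F.* v))
      }
      where
      open import Algebra.Solver.Ring.NaturalCoefficients.Default F.commutativeSemiring
        using (solve; _:=_; _:+_; _:*_)

  module _ {𝔪 : F.𝒫} (isMaximal : F.IsMaximal 𝔪) where
    open F.IsMaximal isMaximal
    open F.IsIdeal isIdeal

    -- The ideal (x , z) properly contains 𝔪, so 1 = ux + vz, where vz is nilpotent.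
    ∉𝔪⇒unit : ∀ {z r} → 𝔪 ≡ F.⟨ z ⟩ → z F.^ʳ r ≈ F.0# → ∀ i → i ∉ 𝔪 → IsUnit finRing i
    ∉𝔪⇒unit {z} {r} 𝔪≡⟨z⟩ zʳ≈0 i i∉𝔪 with maximal ⟨ element i , z ⟩ (⟨,⟩-isIdeal (element i) z) 𝔪⊆
      where
      𝔪⊆ : 𝔪 Subset.⊆ ⟨ element i , z ⟩
      𝔪⊆ {k} k∈𝔪 with ∈-comprehension⁻ (multiple? z) (subst (k ∈_) 𝔪≡⟨z⟩ k∈𝔪)
      ... | j , refl = ∈-resp-≈ ⟨ element i , z ⟩
        (F.trans (F.+-congʳ (F.zeroˡ (element i))) (F.+-identityˡ _)) (∈⟨,⟩⁺ (element i) z F.0# (element j))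
    ... | inj₁ J≡𝔪 = contradiction (subst₂ _∈_ (index-element i) J≡𝔪 i∈J) i∉𝔪
      where
      i∈J : element i F.∈ ⟨ element i , z ⟩
      i∈J = ∈-resp-≈ ⟨ element i , z ⟩
        (F.trans (F.+-cong (F.*-identityˡ (element i)) (F.zeroˡ z)) (F.+-identityʳ (element i)))
        (∈⟨,⟩⁺ (element i) z F.1# F.0#)
    ... | inj₂ J≡⊤ with ∈⟨,⟩⁻ (element i) z {F.1#} (subst (index F.1# ∈_) (sym J≡⊤) ∈⊤)
    ...   | u , v , 1≈ux+vz with complement-of-nilpotent r (F.sym 1≈ux+vz) [vz]ʳ≈0
      where
      [vz]ʳ≈0 : (v F.* z) F.^ʳ r ≈ F.0#
      [vz]ʳ≈0 = F.trans (^-distrib-* v z r) (F.trans (F.*-congˡ zʳ≈0) (F.zeroʳ (v F.^ʳ r)))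
        where open import Algebra.Properties.CommutativeSemiring.Exp F.commutativeSemiring using (^-distrib-*)
    ...     | w , wx≈1 = index w , index-cong (F.trans (F.*-congʳ (element-index w)) wx≈1)

    -- Each residue class is a translate of 𝔪.
    q*∣𝔪∣≤order : ∀ {q} → HasSize (F.quotient isIdeal) q → q * ∣ 𝔪 ∣ ≤ order
    q*∣𝔪∣≤order {q} residues = begin
      q * ∣ 𝔪 ∣                                   ≡⟨ sum-const q ∣ 𝔪 ∣ ⟨
      sum {q} (λ _ → ∣ 𝔪 ∣)                       ≤⟨ sum-mono-≤ _ _ class-size ⟩
      ∑∑ (λ j i → 1 * χ ⁅ class (element i) ⁆ j)  ≡⟨ ∑∑-fibres (λ i → class (element i)) (λ _ → 1) ⟩
      sum {order} (λ _ → 1)                       ≡⟨ trans (sum-const order 1) (*-identityʳ order) ⟩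
      order                                       ∎
      where
      open ≤-Reasoning
      module Q = Inverse residues
      class : Carrier → Fin q
      class = Q.to
      class-size : ∀ j → ∣ 𝔪 ∣ ≤ sum (λ i → 1 * χ ⁅ class (element i) ⁆ j)
      class-size j = begin
        ∣ 𝔪 ∣
          ≡⟨ sum-χ 𝔪 ⟨
        sum (χ 𝔪)
          ≤⟨ sum-mono-≤ _ _ pointwise ⟩
        sum (λ i → 1 * χ ⁅ class (element (e ⊕ i)) ⁆ j)
          ≡⟨ sum-reindex (translation finRing e) (λ i → 1 * χ ⁅ class (element i) ⁆ j) ⟩
        sum (λ i → 1 * χ ⁅ class (element i) ⁆ j) ∎
        where
        open FinRing finRing using (_⊕_)
        e = index (Q.from j)
        class-e⊕ : ∀ i → i ∈ 𝔪 → class (element (e ⊕ i)) ≡ j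
        class-e⊕ i i∈𝔪 = trans (Q.to-cong (∈-resp-≈ 𝔪 i≈[e+i]-e (subst (_∈ 𝔪) (sym (index-element i)) i∈𝔪)))
                               (Q.strictlyInverseˡ j)
          where
          i≈[e+i]-e : element i ≈ element (e ⊕ i) F.- Q.from j
          i≈[e+i]-e = F.sym (F.trans
            (F.+-congʳ (F.trans (element-index _) (F.+-congʳ (element-index (Q.from j)))))
            (xyx⁻¹≈y (Q.from j) (element i)))
            where open import Algebra.Properties.AbelianGroup F.+-abelianGroup using (xyx⁻¹≈y)
        pointwise : ∀ i → χ 𝔪 i ≤ 1 * χ ⁅ class (element (e ⊕ i)) ⁆ j
        pointwise i with i ∈? 𝔪
        ... | no i∉𝔪  = subst (_≤ 1 * χ ⁅ class (element (e ⊕ i)) ⁆ j) (sym (χ-∉ 𝔪 i i∉𝔪)) z≤n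
        ... | yes i∈𝔪 = subst (χ 𝔪 i ≤_)
          (sym (cong (1 *_) (χ-∈ (subst (λ k → j ∈ ⁅ k ⁆) (sym (class-e⊕ i i∈𝔪)) (x∈⁅x⁆ j)))))
          (χ≤1 𝔪 i)

  sum? : ∀ A B → Decidable λ k → ∃[ i ] ∃[ j ] (i ∈ A × j ∈ B × k ≡ index (element i F.+ element j))
  sum? A B k = any? λ i → any? λ j → i ∈? A ×-dec j ∈? B ×-dec k ≟ index (element i F.+ element j)

  square? : ∀ A → Decidable λ k → ∃[ i ] (i ∈ A × k ≡ index (element i F.* element i))
  square? A k = any? λ i → i ∈? A ×-dec k ≟ index (element i F.* element i)

  open FinRing finRing using (_⊕_)

  ⊕∈⊕ : ∀ A B {i j} → i ∈ A → j ∈ B → i ⊕ j ∈ A F.⊕ B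
  ⊕∈⊕ A B i∈A j∈B = ∈-comprehension⁺ (sum? A B) (_ , _ , i∈A , j∈B , refl)

  sq∈squares : ∀ A {i} → i ∈ A → sq finRing i ∈ F.squares A
  sq∈squares A i∈A = ∈-comprehension⁺ (square? A) (_ , i∈A , refl)

-- Parity of odd prime powers.

2∣m^k⇒2∣m : ∀ m k → 2 ∣ m ^ k → 2 ∣ m
2∣m^k⇒2∣m m zero    2∣1 = contradiction (∣1⇒≡1 2∣1) λ ()
2∣m^k⇒2∣m m (suc k) 2∣m^1+k with euclidsLemma m (m ^ k) prime[2] 2∣m^1+k
... | inj₁ 2∣m   = 2∣m
... | inj₂ 2∣m^k = 2∣m^k⇒2∣m m k 2∣m^k

2∤⇒odd : ∀ n → ¬ 2 ∣ n → n ≡ 1 + n / 2 * 2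
2∤⇒odd n 2∤n with n % 2 in n%2≡ | m%n<n n 2 | m≡m%n+[m/n]*n n 2
... | 0           | _             | _  = contradiction (m%n≡0⇒n∣m n 2 n%2≡) 2∤n
... | 1           | _             | eq = eq
... | suc (suc _) | s≤s (s≤s ())  | _

oddPrimePower⇒2∤ : ∀ {q} → OddPrimePower q → ¬ 2 ∣ q
oddPrimePower⇒2∤ (p , k , p-prime , p≢2 , _ , refl) 2∣p^k
  with prime⇒irreducible p-prime (2∣m^k⇒2∣m p k 2∣p^k)
... | inj₂ 2≡p = p≢2 (sym 2≡p)

-- The constant, and passage to rational numbers.

C : ℚ
-- Its square is 1/16, matching the 16 of `sum-square-dichotomy`.
C = ℤ.+ 1 ℚ./ 4

C²*-≤ : ∀ m d k .{{_ : NonZero d}} → m ≤ 16 * (k * d) → C ℚ.* C ℚ.* (ℤ.+ m ℚ./ d) ℚ.≤ fromℕ k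
C²*-≤ m d@(suc d-1) k m≤16kd = ℚ.toℚᵘ-cancel-≤ (begin
  ℚ.toℚᵘ (C ℚ.* C ℚ.* (ℤ.+ m ℚ./ d))              ≃⟨ ℚ.toℚᵘ-homo-* (C ℚ.* C) (ℤ.+ m ℚ./ d) ⟩
  ℚ.toℚᵘ (C ℚ.* C) ℚᵘ.* ℚ.toℚᵘ (ℤ.+ m ℚ./ d)      ≃⟨ ℚᵘ.*-congˡ {ℚ.toℚᵘ (C ℚ.* C)}
                                                     (ℚ.toℚᵘ-fromℚᵘ (mkℚᵘ (ℤ.+ m) d-1)) ⟩
  -- Unnormalised fractions compare by cross-multiplication. `mkℚᵘ` takes the denominator less one,
  -- so the first factor is 1/16 and the second m/d.
  mkℚᵘ (ℤ.+ 1) 15 ℚᵘ.* mkℚᵘ (ℤ.+ m) d-1             ≤⟨ *≤* numerators ⟩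
  mkℚᵘ (ℤ.+ k) 0                                  ≃⟨ ℚ.toℚᵘ-fromℚᵘ (mkℚᵘ (ℤ.+ k) 0) ⟨
  ℚ.toℚᵘ (fromℕ k)                              ∎)
  where
  open ℚᵘ.≤-Reasoning
  numerators : ℤ.+ 1 ℤ.* ℤ.+ m ℤ.* ℤ.+ 1 ℤ.≤ ℤ.+ k ℤ.* ℤ.+ (16 * d)
  numerators = subst₂ ℤ._≤_
    (sym (trans (ℤ.*-identityʳ (ℤ.+ 1 ℤ.* ℤ.+ m)) (ℤ.*-identityˡ (ℤ.+ m))))
    (trans (cong ℤ.+_ (swap k d)) (ℤ.pos-* k (16 * d)))
    (ℤ.+≤+ m≤16kd)
    where
    swap : ∀ k d → 16 * (k * d) ≡ k * (16 * d)
    swap = solve-∀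

-- A minimum lies below both of its terms, so a bound on either one suffices.
C²*min²≤ : ∀ q r n k .{{_ : NonZero q}} →
           q ^ r * n ≤ 16 * k ⊎ n ^ 4 ≤ 16 * (k * q ^ (2 * r ∸ 1)) →
           C ℚ.* C ℚ.* min² q r n ℚ.≤ fromℕ k
C²*min²≤ q r n k bound = case bound of λ where
    (inj₁ N*n≤) → ℚ.≤-trans (ℚ.*-monoˡ-≤-nonNeg (C ℚ.* C) (ℚ.p⊓q≤p a b))
      (C²*-≤ (q ^ r * n) 1 k (subst (λ x → q ^ r * n ≤ 16 * x) (sym (*-identityʳ k)) N*n≤))
    (inj₂ n⁴≤)  → ℚ.≤-trans (ℚ.*-monoˡ-≤-nonNeg (C ℚ.* C) (ℚ.p⊓q≤q a b))
      (C²*-≤ (n ^ 4) (q ^ (2 * r ∸ 1)) k n⁴≤)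
  where
  instance _ = m^n≢0 q (2 * r ∸ 1)
  a b : ℚ
  a = fromℕ (q ^ r * n)
  b = ℤ.+ (n ^ 4) ℚ./ q ^ (2 * r ∸ 1)

-- The bound for finite valuation rings.

module _ {c ℓ} (R : FiniteValuationRing c ℓ) where
  private
    module R = FiniteValuationRing R

  -- The product of the two sumset sizes is at most the square of their maximum, and |𝔪| N ≤ q^(r-1)
  -- q^r = q^(2r-1).
  max²-dichotomy :
    ∀ {z} → R.IsUniformizer z → ∀ q r .{{_ : NonZero q}} → OddPrimePower q →
    HasSize R.residueField q → R.IsNilpotencyIndex z r → R.order ≡ q ^ r →
    ∀ A → 2 * q ^ (r ∸ 1) ≤ ∣ A ∣ →
    let k = (∣ A R.⊕ A ∣ ⊔ ∣ R.squares A R.⊕ R.squares A ∣) ^ 2 in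
    q ^ r * ∣ A ∣ ≤ 16 * k ⊎ ∣ A ∣ ^ 4 ≤ 16 * (k * q ^ (2 * r ∸ 1))
  -- A nilpotency index is positive, which makes the truncated r - 1 exact.
  max²-dichotomy _ q zero _ _ (() , _) _ _ _
  max²-dichotomy {z} 𝔪≡⟨z⟩ q r@(suc r-1) q-odd residues (_ , zʳ≈0 , _) order≡qʳ A 2qʳ⁻¹≤∣A∣ =
    case dichotomy of λ where
      (inj₁ N*n≤) → inj₁ (begin
        q ^ r * a        ≡⟨ cong (_* a) order≡qʳ ⟨
        R.order * a      ≤⟨ N*n≤ ⟩
        16 * (s * t)     ≤⟨ *-monoʳ-≤ 16 s*t≤ ⟩
        16 * s⊔t ^ 2     ∎)
      (inj₂ n⁴≤) → inj₂ (begin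
        a ^ 4                                        ≤⟨ n⁴≤ ⟩
        16 * (s * t * (∣ R.𝔪 ∣ * R.order))           ≤⟨ *-monoʳ-≤ 16 (*-mono-≤ s*t≤ (*-mono-≤ ∣𝔪∣≤ (≤-reflexive order≡qʳ))) ⟩
        16 * (s⊔t ^ 2 * (q ^ r-1 * q ^ r))           ≡⟨ cong (λ e → 16 * (s⊔t ^ 2 * e)) q²ʳ⁻¹ ⟩
        16 * (s⊔t ^ 2 * q ^ (2 * r ∸ 1))             ∎)
    where
    open ≤-Reasoning
    F : FiniteCommutativeRing c ℓ
    F = R.finiteCommutativeRing
    isMaximal : R.IsMaximal R.𝔪
    isMaximal = proj₁ (proj₂ R.isLocal)
    open R.IsIdeal (R.IsMaximal.isIdeal isMaximal)
    a s t s⊔t : ℕ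
    a = ∣ A ∣
    s = ∣ A R.⊕ A ∣
    t = ∣ R.squares A R.⊕ R.squares A ∣
    s⊔t = s ⊔ t
    s*t≤ : s * t ≤ s⊔t ^ 2
    s*t≤ = *-mono-≤ (m≤m⊔n s t) (≤-trans (m≤n⊔m s t) (≤-reflexive (sym (*-identityʳ s⊔t))))
    q²ʳ⁻¹ : q ^ r-1 * q ^ r ≡ q ^ (2 * r ∸ 1)
    -- For r a successor, `2 * r ∸ 1` computes to `r-1 + (r + 0)`.
    q²ʳ⁻¹ = trans (sym (^-distribˡ-+-* q r-1 r)) (cong (λ e → q ^ (r-1 + e)) (sym (+-identityʳ r)))
    ∣𝔪∣≤ : ∣ R.𝔪 ∣ ≤ q ^ r-1
    -- The q residue classes fill at most q^r = q q^(r-1) elements.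
    ∣𝔪∣≤ = *-cancelˡ-≤ q (≤-trans (q*∣𝔪∣≤order F isMaximal residues) (≤-reflexive order≡qʳ))
    2∤order : ¬ 2 ∣ R.order
    2∤order 2∣order = oddPrimePower⇒2∤ q-odd (2∣m^k⇒2∣m q r (subst (2 ∣_) order≡qʳ 2∣order))
    open FinRing (finRing F) using () renaming (_⊕_ to _+ᶠ_; _⊗_ to _*ᶠ_)
    +ᶠ-closed : ∀ {i j} → i ∈ R.𝔪 → j ∈ R.𝔪 → i +ᶠ j ∈ R.𝔪
    +ᶠ-closed i∈𝔪 j∈𝔪 = +-closed (subst (_∈ R.𝔪) (sym (index-element F _)) i∈𝔪)
                                 (subst (_∈ R.𝔪) (sym (index-element F _)) j∈𝔪)
    *ᶠ-closed : ∀ i {j} → j ∈ R.𝔪 → i *ᶠ j ∈ R.𝔪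
    *ᶠ-closed i j∈𝔪 = *-closed (R.element i) (subst (_∈ R.𝔪) (sym (index-element F _)) j∈𝔪)
    dichotomy : R.order * a ≤ 16 * (s * t) ⊎ a ^ 4 ≤ 16 * (s * t * (∣ R.𝔪 ∣ * R.order))
    dichotomy = sum-square-dichotomy (finRing F) R.𝔪 +ᶠ-closed *ᶠ-closed
      (∉𝔪⇒unit F isMaximal {r = r} 𝔪≡⟨z⟩ zʳ≈0)
      (odd⇒unit-2 (finRing F) (R.order / 2) (2∤⇒odd R.order 2∤order))
      A (A R.⊕ A) (R.squares A) (R.squares A R.⊕ R.squares A)
      (⊕∈⊕ F A A) (sq∈squares F A) (⊕∈⊕ F (R.squares A) (R.squares A))
      (≤-trans (*-monoʳ-≤ 2 ∣𝔪∣≤) 2qʳ⁻¹≤∣A∣)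

theorem1p4 : (c ℓ : Level) →
    ∃[ C ] (0ℚ ℚ.< C ×
    ((R : FiniteValuationRing c ℓ) →
    let module R = FiniteValuationRing R in
    (z : R.Carrier) → R.IsUniformizer z →
    (q r : ℕ) .{{_ : NonZero q}} →
    OddPrimePower q →
    HasSize R.residueField q →
    R.IsNilpotencyIndex z r →
    R.order ≡ q ^ r →
    (A : R.𝒫) → 2 * q ^ (r ∸ 1) ≤ ∣ A ∣ →
    C ℚ.* C ℚ.* min² q r ∣ A ∣
    ℚ.≤ fromℕ ((∣ A R.⊕ A ∣ ⊔ ∣ R.squares A R.⊕ R.squares A ∣) ^ 2)))
theorem1p4 c ℓ = C , ℚ.*<* (ℤ.+<+ (s≤s z≤n)) ,
  λ R z 𝔪≡⟨z⟩ q r q-odd residues nilpotency order≡qʳ A 2qʳ⁻¹≤∣A∣ →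
    let module R = FiniteValuationRing R in
    C²*min²≤ q r ∣ A ∣ ((∣ A R.⊕ A ∣ ⊔ ∣ R.squares A R.⊕ R.squares A ∣) ^ 2)
      (max²-dichotomy R 𝔪≡⟨z⟩ q r q-odd residues nilpotency order≡qʳ A 2qʳ⁻¹≤∣A∣)
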